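{- The parameters $n,k,\lambda,\mu$ of nontrivial strongly regular graphs satisfy $$\lambda = k^2/n + o(n) \quad\text{and}\quad \mu = k^2/n + o(n)$$ as $n\to\infty$. That is: for every $\varepsilon>0$ there exists $n_0$ such that for every nontrivial strongly regular graph with parameters $n,k,\lambda,\mu$ and $n\ge n_0$, $$\left|\lambda - \frac{k^2}{n}\right| \le \varepsilon n \quad\text{and}\quad \left|\mu - \frac{k^2}{n}\right| \le \varepsilon n.$$
   Context: Graphs are finite and simple. For a set $R$ of vertices of a graph $G$, the codegree $\widehat{d}(R)$ is the number of vertices of $G$ joined to every vertex in $R$; write $\widehat d(uv)$ for $\widehat d(\{u,v\})$. A strongly regular graph (srg) with parameters $n,k,\lambda,\mu$ is a $k$-regular graph of order $n$ such that, for distinct vertices $u,v$, $\widehat{d}(uv)=\lambda$ if $uv$ is an edge and $\widehat{d}(uv)=\mu$ if $uv$ is not an edge. A strongly regular graph is called trivial if it or its complement is a union of disjoint cliques (i.e. it is a graph $rK_m$, a disjoint union of $r$ complete graphs on $m$ vertices, or the complement of such a graph); otherwise it is nontrivial. -}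

module Defs where

open import Data.Fin.Base using (Fin)
import Data.Fin.Properties as Fin
open import Data.Fin.Subset using (Subset; _∈_; _∪_; ⁅_⁆)
open import Data.Fin.Subset.Properties using (_∈?_)
open import Data.Nat.Base using (ℕ)
open import Data.Product.Base using (_×_; _,_; proj₁; ∃-syntax)
open import Data.Product.Properties using (≡-dec)
open import Data.Sum.Base using (_⊎_)
open import Data.Vec.Base using (count; allFin)
open import Function.Base using (_∘_)
open import Function.Bundles using (_⇔_; _⤖_; module Bijection)
open import Level using (0ℓ)
open import Relation.Binary.Core using (Rel)
open import Relation.Binary.Definitions using (Decidable; Irreflexive; Symmetric)
open import Relation.Binary.PropositionalEquality using (_≡_; _≢_; sym; ≢-sym)
open import Relation.Nullary using (¬_)
open import Relation.Nullary.Decidable using (¬?; _×-dec_; _→-dec_)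

-- Simple graphs on V.  Finite graphs of order n are taken on Fin n; V is kept
-- general so that r·K m below can live on Fin r × Fin m.
record Graph (V : Set) : Set₁ where
  infix 4 _~_ _~?_
  field
    _~_      : Rel V 0ℓ
    _~?_     : Decidable _~_
    ~-sym    : Symmetric _~_
    ~-irrefl : Irreflexive _≡_ _~_

record _≅_ {V W : Set} (G : Graph V) (H : Graph W) : Set where
  private
    module G = Graph G
    module H = Graph H
  field
    bijection : V ⤖ W
  open Bijection bijection public using (to)
  field
    preserves : ∀ u v → (u G.~ v) ⇔ (to u H.~ to v)

complement : ∀ {n} → Graph (Fin n) → Graph (Fin n)
complement G = record
  { _~_      = λ u v → u ≢ v × ¬ (u ~ v)
  ; _~?_     = λ u v → ¬? (u Fin.≟ v) ×-dec ¬? (u ~? v)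
  ; ~-sym    = λ (u≢v , u≁v) → ≢-sym u≢v , u≁v ∘ ~-sym
  ; ~-irrefl = λ u≡v (u≢v , _) → u≢v u≡v
  }
  where open Graph G

-- The disjoint union of r complete graphs on m vertices each; (i , a) is the
-- a-th vertex of the i-th clique.
_·K_ : ∀ r m → Graph (Fin r × Fin m)
r ·K m = record
  { _~_      = λ u v → u ≢ v × proj₁ u ≡ proj₁ v
  ; _~?_     = λ u v → ¬? (≡-dec Fin._≟_ Fin._≟_ u v) ×-dec (proj₁ u Fin.≟ proj₁ v)
  ; ~-sym    = λ (u≢v , i≡j) → ≢-sym u≢v , sym i≡j
  ; ~-irrefl = λ u≡v (u≢v , _) → u≢v u≡v
  }

module _ {n : ℕ} (G : Graph (Fin n)) where
  open Graph G

  degree : Fin n → ℕ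
  degree u = count (u ~?_) (allFin n)

  codegree : Subset n → ℕ
  codegree R = count (λ w → Fin.all? (λ u → (u ∈? R) →-dec (w ~? u))) (allFin n)

  -- ℓ is the parameter usually written λ.
  record IsStronglyRegular (k ℓ μ : ℕ) : Set where
    field
      regular     : ∀ u → degree u ≡ k
      adjacent    : ∀ u v → u ≢ v → u ~ v → codegree (⁅ u ⁆ ∪ ⁅ v ⁆) ≡ ℓ
      nonadjacent : ∀ u v → u ≢ v → ¬ (u ~ v) → codegree (⁅ u ⁆ ∪ ⁅ v ⁆) ≡ μ

  IsUnionOfDisjointCliques : Set
  IsUnionOfDisjointCliques = ∃[ r ] ∃[ m ] G ≅ (r ·K m)

Trivial : ∀ {n} → Graph (Fin n) → Set
Trivial G = IsUnionOfDisjointCliques G ⊎ IsUnionOfDisjointCliques (complement G)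

Nontrivial : ∀ {n} → Graph (Fin n) → Set
Nontrivial G = ¬ Trivial G

{-# OPTIONS --safe #-}
module Submission where

-- Let D = λ − μ and let A_u be the rows of the adjacency matrix.  The Gram matrix of the rows is
-- μ J + D A + (k − μ) I, and counting walks of length two shows that n λ − k² and n μ − k² are at
-- most n |D| + n in absolute value, so it is enough to show D = o(n).
--
-- A nontrivial graph contains u ~ w ~ v with u, v distinct and not adjacent, and dually in the
-- complement.  Since 0/1-vectors satisfy ⟨A_u − A_w , A_v − A_w⟩ ≥ 0, this gives |D| ≤ k − λ and
-- |D| ≤ k − μ.
--
-- By Ramsey's theorem a large graph has a clique or an independent set u₁ v₁ … u_T v_T.  All inner
-- products among its rows agree, so the vectors x_i = A_{u_i} − A_{v_i} are orthogonal, of the same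
-- norm, and by the above |⟨x_i , A_w⟩| ≥ |D x_i(w)| for every vertex w.  Summing Bessel's inequality
-- for the A_w over w gives T D² ≤ n k ≤ n².

open import Defs
import Algebra.Properties.Semiring.Sum
open import Data.Bool.Base using (Bool; true; false; _∧_; if_then_else_)
open import Data.Fin.Base using (Fin; zero; suc; cast)
import Data.Fin.Properties as Fin
open import Data.Fin.Subset using (_∈_; _∪_; ⁅_⁆)
open import Data.Fin.Subset.Properties using (_∈?_; x∈p∪q⁻; x∈p∪q⁺; x∈⁅x⁆; x∈⁅y⁆⇒x≡y)
open import Data.Integer.Base as ℤ
  using (ℤ; +_; 0ℤ; 1ℤ; -1ℤ; _+_; _*_; _-_; -_; _≤_; _<_; ∣_∣)
import Data.Integer.Properties as ℤ
open import Data.Integer.Tactic.RingSolver using (solve-∀)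
open import Data.List.Base as List using (List; []; _∷_; length)
open import Data.List.Membership.Propositional using () renaming (_∈_ to _∈ˡ_)
open import Data.List.Membership.Propositional.Properties
  using (∈-filter⁺; ∈-filter⁻; ∈-lookup; ∈-allFin)
import Data.List.Properties as List
open import Data.List.Relation.Unary.All as All using (All; []; _∷_)
import Data.List.Relation.Unary.All.Properties as All
open import Data.List.Relation.Unary.AllPairs as AllPairs using (AllPairs; []; _∷_)
import Data.List.Relation.Unary.AllPairs.Properties as AllPairs
open import Data.List.Relation.Unary.Any as Any using (Any; index)
import Data.List.Relation.Unary.Any.Properties as Any
import Data.List.Relation.Unary.Unique.DecSetoid.Properties as DecUnique
import Data.List.Relation.Unary.Unique.Propositional.Properties as Unique
open import Data.Nat.Base as ℕ using (ℕ; zero; suc; NonZero)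
import Data.Nat.Properties as ℕ
import Data.Nat.Tactic.RingSolver as ℕ-Solver
open import Data.Product.Base using (_×_; _,_; proj₁; proj₂; ∃-syntax)
open import Data.Rational.Base as ℚ using (ℚ; 0ℚ)
import Data.Rational.Properties as ℚ
open import Data.Rational.Unnormalised.Base as ℚᵘ using (mkℚᵘ)
import Data.Rational.Unnormalised.Properties as ℚᵘ
open import Data.Sum.Base as Sum using (_⊎_; inj₁; inj₂; [_,_]′)
open import Data.Unit.Base using (⊤; tt)
open import Data.Vec.Base as Vec using (count)
open import Data.Vec.Properties using (count≤n)
open import Function.Base using (_∘_; id; _$_)
open import Function.Bundles using (mk⇔; mk↔ₛ′)
open import Function.Properties.Inverse using (↔⇒⤖)
open import Level using (0ℓ)
open import Relation.Binary.Bundles using (DecSetoid)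
open import Relation.Binary.Core using (Rel)
open import Relation.Binary.Definitions as Binary using (tri<; tri≈; tri>)
open import Relation.Binary.PropositionalEquality
open import Relation.Nullary using (¬_; Dec; does; yes; no; contradiction)
open import Relation.Nullary.Decidable
  using (¬?; dec-false; does-⇔; _×-dec_; _⊎-dec_; _→-dec_; decidable-stable)
open import Relation.Unary using (Pred; Decidable)

private
  module Σ = Algebra.Properties.Semiring.Sum ℤ.+-*-semiring
open Σ using (sum; ∑-distrib-+; ∑-comm)

-- Integer inequalities

0≤* : ∀ {i j} → 0ℤ ≤ i → 0ℤ ≤ j → 0ℤ ≤ i * j
0≤* {i} {j} 0≤i 0≤j = subst (_≤ i * j) (ℤ.*-zeroʳ i) (ℤ.*-monoˡ-≤-nonNeg i {{ℤ.nonNegative 0≤i}} 0≤j)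

0≤i*i : ∀ i → 0ℤ ≤ i * i
0≤i*i (+ n)      = 0≤* {+ n} {+ n} (ℤ.+≤+ ℕ.z≤n) (ℤ.+≤+ ℕ.z≤n)
0≤i*i ℤ.-[1+ n ] = ℤ.+≤+ ℕ.z≤n

≤-by-difference : ∀ {i j d} → j - i ≡ d → 0ℤ ≤ d → i ≤ j
≤-by-difference eq 0≤d = ℤ.0≤i-j⇒j≤i (subst (0ℤ ≤_) (sym eq) 0≤d)

square-mono : ∀ {d h} → d ≤ h → - d ≤ h → d * d ≤ h * h
square-mono {d} {h} d≤h -d≤h =
  ≤-by-difference {d = (h - d) * (h - - d)} (eq h d) (0≤* (ℤ.i≤j⇒0≤j-i d≤h) (ℤ.i≤j⇒0≤j-i -d≤h))
  where
  eq : ∀ h d → h * h - d * d ≡ (h - d) * (h - - d)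
  eq = solve-∀

-- Finite sums of integers

∑-cong : ∀ {n} {f g : Fin n → ℤ} → (∀ i → f i ≡ g i) → sum f ≡ sum g
∑-cong f≗g = Σ.sum-cong-≗ f≗g

∑-*ˡ : ∀ {n} c (f : Fin n → ℤ) → sum (λ i → c * f i) ≡ c * sum f
∑-*ˡ c f = sym (Σ.*-distribˡ-sum c f)

∑-mono-≤ : ∀ {n} {f g : Fin n → ℤ} → (∀ i → f i ≤ g i) → sum f ≤ sum g
∑-mono-≤ {zero}  f≤g = ℤ.≤-refl
∑-mono-≤ {suc n} f≤g = ℤ.+-mono-≤ (f≤g zero) (∑-mono-≤ (f≤g ∘ suc))

∑-const : ∀ n c → sum {n} (λ _ → c) ≡ + n * c
∑-const zero    c = sym (ℤ.*-zeroˡ c)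
∑-const (suc n) c = trans (cong (λ s → c + s) (∑-const n c)) (sym (ℤ.suc-* (+ n) c))

0≤∑ : ∀ {n} {f : Fin n → ℤ} → (∀ i → 0ℤ ≤ f i) → 0ℤ ≤ sum f
0≤∑ {n} {f} 0≤f = subst (_≤ sum f) (trans (∑-const n 0ℤ) (ℤ.*-zeroʳ (+ n))) (∑-mono-≤ 0≤f)

-- Inner products of integer vectors

infix 7 ⟨_,_⟩

⟨_,_⟩ : ∀ {n} → (Fin n → ℤ) → (Fin n → ℤ) → ℤ
⟨ f , g ⟩ = sum (λ i → f i * g i)

⟨⟩-comm : ∀ {n} (f g : Fin n → ℤ) → ⟨ f , g ⟩ ≡ ⟨ g , f ⟩
⟨⟩-comm f g = ∑-cong (λ i → ℤ.*-comm (f i) (g i))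

⟨⟩-linearʳ : ∀ {n} (f g h : Fin n → ℤ) c d →
             ⟨ f , (λ i → c * g i + d * h i) ⟩ ≡ c * ⟨ f , g ⟩ + d * ⟨ f , h ⟩
⟨⟩-linearʳ f g h c d = begin
  sum (λ i → f i * (c * g i + d * h i))                     ≡⟨ ∑-cong (λ i → eq (f i) (g i) (h i) c d) ⟩
  sum (λ i → c * (f i * g i) + d * (f i * h i))
    ≡⟨ ∑-distrib-+ (λ i → c * (f i * g i)) (λ i → d * (f i * h i)) ⟩
  sum (λ i → c * (f i * g i)) + sum (λ i → d * (f i * h i))
    ≡⟨ cong₂ _+_ (∑-*ˡ c (λ i → f i * g i)) (∑-*ˡ d (λ i → f i * h i)) ⟩
  c * ⟨ f , g ⟩ + d * ⟨ f , h ⟩                             ∎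
  where
  open ≡-Reasoning
  eq : ∀ x y z c d → x * (c * y + d * z) ≡ c * (x * y) + d * (x * z)
  eq = solve-∀

⟨⟩-linearˡ : ∀ {n} (f g h : Fin n → ℤ) c d →
             ⟨ (λ i → c * g i + d * h i) , f ⟩ ≡ c * ⟨ g , f ⟩ + d * ⟨ h , f ⟩
⟨⟩-linearˡ f g h c d = begin
  ⟨ (λ i → c * g i + d * h i) , f ⟩ ≡⟨ ⟨⟩-comm (λ i → c * g i + d * h i) f ⟩
  ⟨ f , (λ i → c * g i + d * h i) ⟩ ≡⟨ ⟨⟩-linearʳ f g h c d ⟩
  c * ⟨ f , g ⟩ + d * ⟨ f , h ⟩     ≡⟨ cong₂ (λ x y → c * x + d * y) (⟨⟩-comm f g) (⟨⟩-comm f h) ⟩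
  c * ⟨ g , f ⟩ + d * ⟨ h , f ⟩     ∎
  where open ≡-Reasoning

0≤⟨f,f⟩ : ∀ {n} (f : Fin n → ℤ) → 0ℤ ≤ ⟨ f , f ⟩
0≤⟨f,f⟩ f = 0≤∑ (λ i → 0≤i*i (f i))

-- Sums over lists and Bessel's inequality

listSum : ∀ {A : Set} → (A → ℤ) → List A → ℤ
listSum f []       = 0ℤ
listSum f (x ∷ xs) = f x + listSum f xs

listSum-cong : ∀ {A : Set} {f g : A → ℤ} {xs} → All (λ x → f x ≡ g x) xs → listSum f xs ≡ listSum g xs
listSum-cong []         = refl
listSum-cong (eq ∷ eqs) = cong₂ _+_ eq (listSum-cong eqs)

listSum-*ˡ : ∀ {A : Set} c (f : A → ℤ) xs → listSum (λ x → c * f x) xs ≡ c * listSum f xs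
listSum-*ˡ c f []       = sym (ℤ.*-zeroʳ c)
listSum-*ˡ c f (x ∷ xs) = trans (cong (λ s → c * f x + s) (listSum-*ˡ c f xs)) (sym (ℤ.*-distribˡ-+ c _ _))

listSum-≥ : ∀ {A : Set} {c} {f : A → ℤ} {xs} → All (λ x → c ≤ f x) xs → + length xs * c ≤ listSum f xs
listSum-≥ []                  = ℤ.≤-refl
listSum-≥ {c = c} (_∷_ {xs = xs} c≤ c≤s) =
  subst (_≤ _) (sym (ℤ.suc-* (+ length xs) c)) (ℤ.+-mono-≤ c≤ (listSum-≥ c≤s))

∑-listSum-comm : ∀ {n} {A : Set} (f : A → Fin n → ℤ) xs →
                 sum (λ i → listSum (λ x → f x i) xs) ≡ listSum (λ x → sum (f x)) xs
∑-listSum-comm {n} f []       = trans (∑-const n 0ℤ) (ℤ.*-zeroʳ (+ n))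
∑-listSum-comm     f (x ∷ xs) = trans (∑-distrib-+ (f x) _) (cong (λ s → sum (f x) + s) (∑-listSum-comm f xs))

-- The induction replaces v by H v − ⟨ x , v ⟩ x, which keeps everything integral.
bessel : ∀ {n} H → 0ℤ < H → (xs : List (Fin n → ℤ)) →
         All (λ x → ⟨ x , x ⟩ ≡ H) xs → AllPairs (λ x y → ⟨ x , y ⟩ ≡ 0ℤ) xs →
         ∀ v → listSum (λ x → ⟨ x , v ⟩ * ⟨ x , v ⟩) xs ≤ H * ⟨ v , v ⟩
bessel H 0<H [] [] [] v = 0≤* (ℤ.<⇒≤ 0<H) (0≤⟨f,f⟩ v)
bessel H 0<H (x ∷ xs) (xx≡H ∷ norms) (x⊥xs ∷ orth) v =
  subst (c * c + S ≤_) (eq₂ (c * c) (H * V)) (ℤ.+-monoʳ-≤ (c * c) S≤)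
  where
  instance
    _ = ℤ.positive 0<H
    _ = ℤ.nonNegative (ℤ.<⇒≤ 0<H)
  c = ⟨ x , v ⟩
  V = ⟨ v , v ⟩
  v′ : Fin _ → ℤ
  v′ i = H * v i + (- c) * x i
  S  = listSum (λ y → ⟨ y , v ⟩ * ⟨ y , v ⟩) xs
  S′ = listSum (λ y → ⟨ y , v′ ⟩ * ⟨ y , v′ ⟩) xs

  eq₁ : ∀ H t c → (H * t + (- c) * 0ℤ) * (H * t + (- c) * 0ℤ) ≡ H * (H * (t * t))
  eq₁ = solve-∀
  eq₂ : ∀ p q → p + (q - p) ≡ q
  eq₂ = solve-∀
  eq₃ : ∀ H V c → H * (H * V + (- c) * c) + (- c) * (H * c + (- c) * H) ≡ H * (H * V - c * c)
  eq₃ = solve-∀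

  S′≡ : S′ ≡ H * (H * S)
  S′≡ = begin
    -- Each y in `xs` is orthogonal to x, so ⟨y, v′⟩ = H ⟨y, v⟩.
    S′ ≡⟨ listSum-cong (All.map (λ {y} x⊥y → trans
            (cong (λ t → t * t) (trans (⟨⟩-linearʳ y v x H (- c))
              (cong (λ t → H * ⟨ y , v ⟩ + (- c) * t) (trans (⟨⟩-comm y x) x⊥y))))
            (eq₁ H ⟨ y , v ⟩ c)) x⊥xs) ⟩
    listSum (λ y → H * (H * (⟨ y , v ⟩ * ⟨ y , v ⟩))) xs ≡⟨ listSum-*ˡ H _ xs ⟩
    H * listSum (λ y → H * (⟨ y , v ⟩ * ⟨ y , v ⟩)) xs   ≡⟨ cong (H *_) (listSum-*ˡ H _ xs) ⟩
    H * (H * S)                                          ∎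
    where open ≡-Reasoning

  V′≡ : ⟨ v′ , v′ ⟩ ≡ H * (H * V - c * c)
  V′≡ = begin
    ⟨ v′ , v′ ⟩                         ≡⟨ ⟨⟩-linearˡ v′ v x H (- c) ⟩
    H * ⟨ v , v′ ⟩ + (- c) * ⟨ x , v′ ⟩ ≡⟨ cong₂ (λ s t → H * s + (- c) * t)
                                             (trans (⟨⟩-linearʳ v v x H (- c)) (cong (λ t → H * V + (- c) * t) (⟨⟩-comm v x)))
                                             (trans (⟨⟩-linearʳ x v x H (- c)) (cong (λ t → H * c + (- c) * t) xx≡H)) ⟩
    H * (H * V + (- c) * c) + (- c) * (H * c + (- c) * H) ≡⟨ eq₃ H V c ⟩
    H * (H * V - c * c) ∎
    where open ≡-Reasoning

  S≤ : S ≤ H * V - c * c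
  -- The induction hypothesis for v′ reads H² S ≤ H · H (H V - c²), and H > 0 cancels twice.
  S≤ = ℤ.*-cancelˡ-≤-pos S _ H $ ℤ.*-cancelˡ-≤-pos (H * S) _ H $
       subst₂ _≤_ S′≡ (cong (H *_) V′≡) (bessel H 0<H xs norms orth v′)

-- Indicators

𝟙 : Bool → ℤ
𝟙 b = if b then 1ℤ else 0ℤ

𝟙-idem : ∀ b → 𝟙 b * 𝟙 b ≡ 𝟙 b
𝟙-idem false = refl
𝟙-idem true  = refl

-- The induction needs an arbitrary `f`: the tail of `allFin` is a tabulation of `suc`, not again an
-- `allFin`.
count-tabulate : ∀ {n} {A : Set} {P : Pred A 0ℓ} (P? : Decidable P) (f : Fin n → A) →
                 + count P? (Vec.tabulate f) ≡ sum (λ i → 𝟙 (does (P? (f i))))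
count-tabulate {zero}  P? f = refl
count-tabulate {suc n} P? f with ih ← count-tabulate P? (f ∘ suc) | does (P? (f zero))
... | true  = cong ℤ.suc ih
... | false = trans ih (sym (ℤ.+-identityˡ _))

length-filter-tabulate : ∀ {n} {A : Set} {P : Pred A 0ℓ} (P? : Decidable P) (f : Fin n → A) →
                         + length (List.filter P? (List.tabulate f)) ≡ sum (λ i → 𝟙 (does (P? (f i))))
length-filter-tabulate {zero}  P? f = refl
length-filter-tabulate {suc n} P? f with ih ← length-filter-tabulate P? (f ∘ suc) | does (P? (f zero))
... | true  = cong ℤ.suc ih
... | false = trans ih (sym (ℤ.+-identityˡ _))

δ : ∀ {n} → Fin n → Fin n → ℤ
δ u v = 𝟙 (does (u Fin.≟ v))

∑-δ : ∀ {n} (u : Fin n) → sum (δ u) ≡ 1ℤ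
∑-δ {suc n} zero    = cong ℤ.suc (trans (∑-const n 0ℤ) (ℤ.*-zeroʳ (+ n)))
∑-δ {suc n} (suc u) = trans (ℤ.+-identityˡ _) (∑-δ u)

-- Ramsey's theorem

length-filter-∁ : ∀ {A : Set} {P : Pred A 0ℓ} (P? : Decidable P) (xs : List A) →
                  length (List.filter P? xs) ℕ.+ length (List.filter (λ x → ¬? (P? x)) xs) ≡ length xs
length-filter-∁ P? []       = refl
length-filter-∁ P? (x ∷ xs) with ih ← length-filter-∁ P? xs | does (P? x)
... | true  = cong suc ih
... | false = trans (ℕ.+-suc _ _) (cong suc ih)

-- Pigeonhole after a pivot has been removed; the pivot is the extra one in `suc c`. If a < m, then
-- a + 1 ≤ m absorbs it and 2m ≤ (a + 1) + b ≤ m + b.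
halves : ∀ {m a b c} → 2 ℕ.* m ℕ.≤ suc c → a ℕ.+ b ≡ c → m ℕ.≤ a ⊎ m ℕ.≤ b
halves {m} {a} {b} 2m≤ refl with m ℕ.≤? a
... | yes m≤a = inj₁ m≤a
... | no  m≰a = inj₂ (ℕ.+-cancelˡ-≤ m m b (ℕ.s≤s⁻¹ (begin
  suc (m ℕ.+ m)       ≡⟨ cong (λ t → suc (m ℕ.+ t)) (ℕ.+-identityʳ m) ⟨
  suc (2 ℕ.* m)       ≤⟨ ℕ.s≤s 2m≤ ⟩
  suc (suc a ℕ.+ b)   ≤⟨ ℕ.s≤s (ℕ.+-monoˡ-≤ b (ℕ.≰⇒> m≰a)) ⟩
  suc (m ℕ.+ b)       ∎)))
  where open ℕ.≤-Reasoning

module _ {A : Set} {R S : Rel A 0ℓ} (R? : Binary.Decidable R) where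

  -- Remove a pivot and keep the entries related to it or those unrelated to it, whichever are
  -- numerous enough; this lowers s or t by one and halves the required length. `S` rides along
  -- because unrelated vertices must still be known to be distinct.
  ramsey : ∀ s t (xs : List A) → 2 ℕ.^ (s ℕ.+ t) ℕ.≤ length xs → AllPairs S xs →
           (∃[ ys ] length ys ≡ s × AllPairs (λ x y → S x y × R x y) ys) ⊎
           (∃[ ys ] length ys ≡ t × AllPairs (λ x y → S x y × ¬ R x y) ys)
  ramsey s t xs big ps = Sum.map
    (λ (ys , _ , len , pairs) → ys , len , pairs)
    (λ (ys , _ , len , pairs) → ys , len , pairs)
    (go {λ _ → ⊤} s t xs big ps (All.universal (λ _ → tt) xs))
    where
    -- `Q` collects what is known of the remaining entries. Each recursive call adds the relations
    -- to the pivot, so the pivot can be put in front of the list that comes back.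
    go : ∀ {Q : Pred A 0ℓ} s t (xs : List A) → 2 ℕ.^ (s ℕ.+ t) ℕ.≤ length xs → AllPairs S xs → All Q xs →
         (∃[ ys ] All Q ys × length ys ≡ s × AllPairs (λ x y → S x y × R x y) ys) ⊎
         (∃[ ys ] All Q ys × length ys ≡ t × AllPairs (λ x y → S x y × ¬ R x y) ys)
    go zero    t       xs       big ps       qs       = inj₁ ([] , [] , refl , [])
    go (suc s) zero    xs       big ps       qs       = inj₂ ([] , [] , refl , [])
    go (suc s) (suc t) []       big ps       qs       =
      contradiction big (ℕ.<⇒≱ (ℕ.m^n>0 2 (suc s ℕ.+ suc t)))
    go (suc s) (suc t) (x ∷ xs) big (sx ∷ ps) (qx ∷ qs)
      with halves {2 ℕ.^ (s ℕ.+ suc t)} big (length-filter-∁ (R? x) xs)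
    ... | inj₁ big₁
        with go s (suc t) (List.filter (R? x) xs) big₁ (AllPairs.filter⁺ (R? x) ps)
               (All.zip (All.filter⁺ (R? x) qs , All.zip (All.filter⁺ (R? x) sx , All.all-filter (R? x) xs)))
    ...   | inj₁ (ys , ys∈ , len , pairs) =
            inj₁ (x ∷ ys , qx ∷ All.map proj₁ ys∈ , cong suc len , All.map proj₂ ys∈ ∷ pairs)
    ...   | inj₂ (ys , ys∈ , len , pairs) = inj₂ (ys , All.map proj₁ ys∈ , len , pairs)
    go (suc s) (suc t) (x ∷ xs) big (sx ∷ ps) (qx ∷ qs) | inj₂ big₂
        with go (suc s) t (List.filter ∁R? xs)
               (subst (λ e → 2 ℕ.^ e ℕ.≤ length (List.filter ∁R? xs)) (ℕ.+-suc s t) big₂)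
               (AllPairs.filter⁺ ∁R? ps)
               (All.zip (All.filter⁺ ∁R? qs , All.zip (All.filter⁺ ∁R? sx , All.all-filter ∁R? xs)))
        where ∁R? = λ y → ¬? (R? x y)
    ...   | inj₁ (ys , ys∈ , len , pairs) = inj₁ (ys , All.map proj₁ ys∈ , len , pairs)
    ...   | inj₂ (ys , ys∈ , len , pairs) =
            inj₂ (x ∷ ys , qx ∷ All.map proj₁ ys∈ , cong suc len , All.map proj₂ ys∈ ∷ pairs)

-- Disjoint unions of cliques

-- Used twice: with `R` an equivalence, where a class has only one representative, and with `R`
-- equality, where a list without repetition lists each vertex once.
lookup-injective : ∀ {A : Set} {R : Rel A 0ℓ} → (∀ {x y} → R x y → R y x) →
                   ∀ {xs} → AllPairs (λ x y → ¬ R x y) xs →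
                   ∀ i j → R (List.lookup xs i) (List.lookup xs j) → i ≡ j
lookup-injective R-sym (_ ∷ _)  zero    zero    _ = refl
lookup-injective R-sym (x ∷ _)  zero    (suc j) r = contradiction r (All.lookup x (∈-lookup j))
lookup-injective R-sym (x ∷ _)  (suc i) zero    r = contradiction (R-sym r) (All.lookup x (∈-lookup i))
lookup-injective R-sym (_ ∷ xs) (suc i) (suc j) r = cong suc (lookup-injective R-sym xs i j r)

module _ {n : ℕ} (G : Graph (Fin n)) where
  open Graph G

  _≈?_ : ∀ u v → Dec (u ≡ v ⊎ u ~ v)
  u ≈? v = (u Fin.≟ v) ⊎-dec (u ~? v)

  closedNeighbourhood : Fin n → List (Fin n)
  closedNeighbourhood u = List.filter (u ≈?_) (List.allFin n)

  -- Adjacency or equality is then an equivalence relation whose classes are the closed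
  -- neighbourhoods. A vertex is sent to the index of its class representative and to its position
  -- in the neighbourhood of that representative; the common size m places all positions in `Fin m`.
  transitive⇒cliques : (∀ u w v → u ~ w → w ~ v → u ≢ v → u ~ v) →
                       ∀ m → (∀ u → length (closedNeighbourhood u) ≡ m) →
                       IsUnionOfDisjointCliques G
  transitive⇒cliques ~-trans m size = r , m , record
    { bijection = ↔⇒⤖ (mk↔ₛ′ to from to∘from from∘to)
    ; preserves = λ u v → mk⇔
        (λ u~v → (λ eq → ~-irrefl (to-injective eq) u~v) , lookup-injective ≈-sym unique _ _
          (≈-trans (≈-sym (≈rep u)) (≈-trans (inj₂ u~v) (≈rep v))))
        (λ (tou≢tov , eq) →
          [ (λ u≡v → contradiction (cong to u≡v) tou≢tov) , id ]′
          (≈-trans (≈rep u) (subst (λ i → List.lookup reps i ≈ v) (sym eq) (≈-sym (≈rep v)))))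
    }
    where
    _≈_ : Fin n → Fin n → Set
    u ≈ v = u ≡ v ⊎ u ~ v

    ≈-sym : ∀ {u v} → u ≈ v → v ≈ u
    ≈-sym = Sum.map sym ~-sym

    ≈-trans : ∀ {u v w} → u ≈ v → v ≈ w → u ≈ w
    ≈-trans (inj₁ refl) v≈w         = v≈w
    ≈-trans (inj₂ u~v)  (inj₁ refl) = inj₂ u~v
    ≈-trans {u} {v} {w} (inj₂ u~v) (inj₂ v~w) with u Fin.≟ w
    ... | yes u≡w = inj₁ u≡w
    ... | no  u≢w = inj₂ (~-trans u v w u~v v~w u≢w)

    ≈-decSetoid : DecSetoid 0ℓ 0ℓ
    ≈-decSetoid = record
      { _≈_ = _≈_
      ; isDecEquivalence = record
        { isEquivalence = record { refl = inj₁ refl ; sym = ≈-sym ; trans = ≈-trans }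
        ; _≟_ = _≈?_
        }
      }

    reps : List (Fin n)
    reps = List.deduplicate _≈?_ (List.allFin n)

    unique : AllPairs (λ u v → ¬ u ≈ v) reps
    unique = DecUnique.deduplicate-! ≈-decSetoid (List.allFin n)

    r = length reps

    rep∈ : ∀ u → Any (u ≈_) reps
    -- Every vertex occurs in `allFin`, and deduplication drops a vertex only in favour of an
    -- equivalent one.
    rep∈ u = Any.deduplicate⁺ _≈?_ (λ y≈x u≈x → ≈-trans u≈x (≈-sym y≈x)) (Any.map inj₁ (∈-allFin u))

    ≈rep : ∀ u → u ≈ List.lookup reps (index (rep∈ u))
    ≈rep u = Any.lookup-index (rep∈ u)

    ∈clique : ∀ u → u ∈ˡ closedNeighbourhood (List.lookup reps (index (rep∈ u)))
    ∈clique u = ∈-filter⁺ (_ ≈?_) (∈-allFin u) (≈-sym (≈rep u))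

    to : Fin n → Fin r × Fin m
    to u = index (rep∈ u) , cast (size _) (index (∈clique u))

    from : Fin r × Fin m → Fin n
    from (i , a) = List.lookup (closedNeighbourhood (List.lookup reps i)) (cast (sym (size _)) a)

    from∘to : ∀ u → from (to u) ≡ u
    from∘to u = trans
      (cong (List.lookup (closedNeighbourhood _)) (Fin.cast-involutive (sym (size _)) (size _) (index (∈clique u))))
      (sym (Any.lookup-index (∈clique u)))

    rep≈from : ∀ i a → List.lookup reps i ≈ from (i , a)
    rep≈from i a = proj₂ (∈-filter⁻ (_ ≈?_) {xs = List.allFin n} (∈-lookup (cast (sym (size _)) a)))

    from-injective : ∀ {i j a b} → from (i , a) ≡ from (j , b) → (i , a) ≡ (j , b)
    from-injective {i} {j} {a} {b} eq
      -- Both representatives are equivalent to the same vertex, so the classes agree; within one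
      -- class the listing has no repetition.
      with refl ← lookup-injective ≈-sym unique i j
             (≈-trans (rep≈from i a) (≈-trans (inj₁ eq) (≈-sym (rep≈from j b))))
      = cong (i ,_) (trans (sym (Fin.cast-involutive (size _) (sym (size _)) a))
          (trans (cong (cast (size _)) (lookup-injective sym (Unique.filter⁺ (_ ≈?_) (Unique.allFin⁺ n)) _ _ eq))
                 (Fin.cast-involutive (size _) (sym (size _)) b)))

    to∘from : ∀ ia → to (from ia) ≡ ia
    -- Injectivity of `from` reduces this to the other inverse law.
    to∘from ia = from-injective (from∘to (from ia))

    to-injective : ∀ {u v} → to u ≡ to v → u ≡ v
    to-injective {u} {v} eq = trans (sym (from∘to u)) (trans (cong from eq) (from∘to v))

-- Rows of the adjacency matrix

infixl 6 _⊖_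
-- Spelled as a linear combination so that `⟨⟩-linearˡ` applies to it directly.
_⊖_ : ∀ {n} → (Fin n → ℤ) → (Fin n → ℤ) → Fin n → ℤ
(f ⊖ g) i = 1ℤ * f i + -1ℤ * g i

⟨⊖,⟩ : ∀ {n} (f g h : Fin n → ℤ) → ⟨ f ⊖ g , h ⟩ ≡ ⟨ f , h ⟩ - ⟨ g , h ⟩
⟨⊖,⟩ f g h = trans (⟨⟩-linearˡ h f g 1ℤ -1ℤ) (eq ⟨ f , h ⟩ ⟨ g , h ⟩)
  where
  eq : ∀ x y → 1ℤ * x + -1ℤ * y ≡ x - y
  eq = solve-∀

⟨⊖,⊖⟩ : ∀ {n} (f g h l : Fin n → ℤ) →
        ⟨ f ⊖ g , h ⊖ l ⟩ ≡ (⟨ f , h ⟩ - ⟨ f , l ⟩) - (⟨ g , h ⟩ - ⟨ g , l ⟩)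
⟨⊖,⊖⟩ f g h l = trans (⟨⊖,⟩ f g (h ⊖ l)) (cong₂ _-_ (swap f) (swap g))
  where
  swap : ∀ f → ⟨ f , h ⊖ l ⟩ ≡ ⟨ f , h ⟩ - ⟨ f , l ⟩
  swap f = trans (⟨⟩-comm f (h ⊖ l)) (trans (⟨⊖,⟩ h l f) (cong₂ _-_ (⟨⟩-comm h f) (⟨⟩-comm l f)))

-- Subtracting one of the values 0 and 1 from two of them leaves two numbers of the same sign.
0≤⟨⊖,⊖⟩ : ∀ {n} (f g h : Fin n → Bool) → 0ℤ ≤ ⟨ (𝟙 ∘ f) ⊖ (𝟙 ∘ g) , (𝟙 ∘ h) ⊖ (𝟙 ∘ g) ⟩
0≤⟨⊖,⊖⟩ f g h = 0≤∑ (λ i → pointwise (f i) (g i) (h i))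
  where
  pointwise : ∀ a b c → 0ℤ ≤ (1ℤ * 𝟙 a + -1ℤ * 𝟙 b) * (1ℤ * 𝟙 c + -1ℤ * 𝟙 b)
  pointwise false false false = ℤ.+≤+ ℕ.z≤n
  pointwise false false true  = ℤ.+≤+ ℕ.z≤n
  pointwise false true  false = ℤ.+≤+ ℕ.z≤n
  pointwise false true  true  = ℤ.+≤+ ℕ.z≤n
  pointwise true  false false = ℤ.+≤+ ℕ.z≤n
  pointwise true  false true  = ℤ.+≤+ ℕ.z≤n
  pointwise true  true  false = ℤ.+≤+ ℕ.z≤n
  pointwise true  true  true  = ℤ.+≤+ ℕ.z≤n

module _ {n : ℕ} (G : Graph (Fin n)) where
  open Graph G

  adj : Fin n → Fin n → Bool
  adj u v = does (u ~? v)

  row : Fin n → Fin n → ℤ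
  row u v = 𝟙 (adj u v)

  row-sym : ∀ u v → row u v ≡ row v u
  row-sym u v = cong 𝟙 (does-⇔ (mk⇔ ~-sym ~-sym) (u ~? v) (v ~? u))

  row-diagonal : ∀ u → row u u ≡ 0ℤ
  row-diagonal u = cong 𝟙 (dec-false (u ~? u) (~-irrefl refl))

  ∑-row : ∀ u → sum (row u) ≡ + degree G u
  ∑-row u = sym (count-tabulate (u ~?_) id)

  ⟨row,row⟩≡degree : ∀ u → ⟨ row u , row u ⟩ ≡ + degree G u
  ⟨row,row⟩≡degree u = trans (∑-cong (λ v → 𝟙-idem (adj u v))) (∑-row u)

  ⟨row,row⟩≡codegree : ∀ u v → ⟨ row u , row v ⟩ ≡ + codegree G (⁅ u ⁆ ∪ ⁅ v ⁆)
  ⟨row,row⟩≡codegree u v = sym (trans (count-tabulate joined? id) (∑-cong joined))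
    where
    R = ⁅ u ⁆ ∪ ⁅ v ⁆
    joined? : ∀ w → Dec (∀ x → x ∈ R → w ~ x)
    joined? w = Fin.all? (λ x → (x ∈? R) →-dec (w ~? x))

    𝟙-∧ : ∀ a b → 𝟙 (a ∧ b) ≡ 𝟙 a * 𝟙 b
    𝟙-∧ false b     = refl
    𝟙-∧ true  false = refl
    𝟙-∧ true  true  = refl

    joined : ∀ w → 𝟙 (does (joined? w)) ≡ row u w * row v w
    joined w = trans
      (cong 𝟙 (does-⇔ (mk⇔
        (λ all → ~-sym (all u (x∈p∪q⁺ (inj₁ (x∈⁅x⁆ u)))) , ~-sym (all v (x∈p∪q⁺ (inj₂ (x∈⁅x⁆ v)))))
        (λ (u~w , v~w) x x∈R →
          [ (λ x∈ → subst (w ~_) (sym (x∈⁅y⁆⇒x≡y u x∈)) (~-sym u~w))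
          , (λ x∈ → subst (w ~_) (sym (x∈⁅y⁆⇒x≡y v x∈)) (~-sym v~w))
          ]′ (x∈p∪q⁻ ⁅ u ⁆ ⁅ v ⁆ x∈R)))
        (joined? w) ((u ~? w) ×-dec (v ~? w))))
      (𝟙-∧ (adj u w) (adj v w))

  length-closedNeighbourhood : ∀ u → + length (closedNeighbourhood G u) ≡ 1ℤ + sum (row u)
  length-closedNeighbourhood u = begin
    + length (closedNeighbourhood G u) ≡⟨ length-filter-tabulate (_≈?_ G u) id ⟩
    sum (λ v → 𝟙 (does (_≈?_ G u v)))  ≡⟨ ∑-cong pointwise ⟩
    sum (λ v → δ u v + row u v)        ≡⟨ ∑-distrib-+ (δ u) (row u) ⟩
    sum (δ u) + sum (row u)            ≡⟨ cong (λ s → s + sum (row u)) (∑-δ u) ⟩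
    1ℤ + sum (row u)                   ∎
    where
    open ≡-Reasoning
    pointwise : ∀ v → 𝟙 (does (_≈?_ G u v)) ≡ δ u v + row u v
    pointwise v with u Fin.≟ v | u ~? v
    ... | yes u≡v | yes u~v = contradiction u~v (~-irrefl u≡v)
    ... | yes _   | no  _   = refl
    ... | no  _   | yes _   = refl
    ... | no  _   | no  _   = refl

  -- Without such a path adjacency is transitive on distinct vertices. The common size of the closed
  -- neighbourhoods is left as a hypothesis, to be supplied by regularity.
  inducedPath : (∀ m → (∀ u → length (closedNeighbourhood G u) ≡ m) → IsUnionOfDisjointCliques G) ⊎
                (∃[ u ] ∃[ w ] ∃[ v ] u ~ w × w ~ v × u ≢ v × ¬ u ~ v)
  inducedPath with Fin.any? (λ u → Fin.any? λ w → Fin.any? λ v →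
    (u ~? w) ×-dec (w ~? v) ×-dec ¬? (u Fin.≟ v) ×-dec ¬? (u ~? v))
  ... | yes path = inj₂ path
  ... | no ¬path = inj₁ (transitive⇒cliques G (λ u w v u~w w~v u≢v →
    decidable-stable (u ~? v) (λ u≁v → ¬path (u , w , v , u~w , w~v , u≢v , u≁v))))

-- Every v is exactly one of: equal to u, adjacent to u, adjacent to u in the complement. The left
-- side is the size of the closed neighbourhood of u in the complement.
∑-row-complement : ∀ {n} (G : Graph (Fin n)) u →
                   1ℤ + sum (row (complement G) u) ≡ + n - + degree G u
∑-row-complement {n} G u = trans (eq (+ degree G u) C) (cong (_- + degree G u) (sym (begin
  + n                                                   ≡⟨ ℤ.*-identityʳ (+ n) ⟨
  + n * 1ℤ                                              ≡⟨ ∑-const n 1ℤ ⟨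
  sum {n} (λ _ → 1ℤ)                                    ≡⟨ ∑-cong pointwise ⟩
  sum (λ v → (δ u v + row G u v) + row (complement G) u v)
    ≡⟨ ∑-distrib-+ (λ v → δ u v + row G u v) (row (complement G) u) ⟩
  sum (λ v → δ u v + row G u v) + C                     ≡⟨ cong (λ s → s + C) (∑-distrib-+ (δ u) (row G u)) ⟩
  (sum (δ u) + sum (row G u)) + C                       ≡⟨ cong₂ (λ s t → (s + t) + C) (∑-δ u) (∑-row G u) ⟩
  (1ℤ + + degree G u) + C                               ∎)))
  where
  open ≡-Reasoning
  open Graph G
  C = sum (row (complement G) u)
  eq : ∀ d c → 1ℤ + c ≡ ((1ℤ + d) + c) - d
  eq = solve-∀
  pointwise : ∀ v → 1ℤ ≡ (δ u v + row G u v) + row (complement G) u v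
  pointwise v with u Fin.≟ v | u ~? v
  ... | yes u≡v | yes u~v = contradiction u~v (~-irrefl u≡v)
  ... | yes _   | no  _   = refl
  ... | no  _   | yes _   = refl
  ... | no  _   | no  _   = refl

-- Differences of rows along disjoint pairs of a list

differences : ∀ {n} → (Fin n → Fin n → ℤ) → List (Fin n) → List (Fin n → ℤ)
differences r (u ∷ v ∷ us) = (r u ⊖ r v) ∷ differences r us
differences r _            = []

module _ {n : ℕ} (r : Fin n → Fin n → ℤ) {R : Fin n → Fin n → Set} where

  All-differences : ∀ {P : (Fin n → ℤ) → Set} → (∀ {u v} → R u v → P (r u ⊖ r v)) →
                    ∀ {us} → AllPairs R us → All P (differences r us)
  All-differences p []                           = []
  All-differences p (_ ∷ [])                     = []
  All-differences p ((uv ∷ _) ∷ (_ ∷ pairs))     = p uv ∷ All-differences p pairs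

  All-differences₁ : ∀ {P : (Fin n → ℤ) → Set} {Q : Fin n → Set} → (∀ {u v} → Q u → Q v → P (r u ⊖ r v)) →
                     ∀ {us} → All Q us → All P (differences r us)
  All-differences₁ p []             = []
  All-differences₁ p (_ ∷ [])       = []
  All-differences₁ p (qu ∷ qv ∷ qs) = p qu qv ∷ All-differences₁ p qs

  -- The pairs are disjoint, so two differences come from four entries of the list, both of the
  -- earlier pair preceding both of the later one. Hence all four cross relations are available.
  AllPairs-differences : ∀ {S : (Fin n → ℤ) → (Fin n → ℤ) → Set} →
    (∀ {u v a b} → R u a → R u b → R v a → R v b → S (r u ⊖ r v) (r a ⊖ r b)) →
    ∀ {us} → AllPairs R us → AllPairs S (differences r us)
  AllPairs-differences s []                             = []
  AllPairs-differences s (_ ∷ [])                       = []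
  AllPairs-differences s ((_ ∷ Ru) ∷ (Rv ∷ pairs)) =
    All-differences₁ (λ (ua , va) (ub , vb) → s ua ub va vb) (All.zip (Ru , Rv)) ∷ AllPairs-differences s pairs

length-differences : ∀ {n} (r : Fin n → Fin n → ℤ) t us → length us ≡ t ℕ.* 2 → length (differences r us) ≡ t
length-differences r zero    []           eq = refl
length-differences r (suc t) (u ∷ v ∷ us) eq =
  cong suc (length-differences r t us (ℕ.suc-injective (ℕ.suc-injective eq)))

-- Inner products of the rows of a strongly regular graph

module StronglyRegular {n : ℕ} (G : Graph (Fin n)) {k ℓ μ : ℕ} (srg : IsStronglyRegular G k ℓ μ) where
  open Graph G
  open IsStronglyRegular srg

  D : ℤ
  D = + ℓ - + μ

  ⟨row,row⟩≡k : ∀ u → ⟨ row G u , row G u ⟩ ≡ + k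
  ⟨row,row⟩≡k u = trans (⟨row,row⟩≡degree G u) (cong +_ (regular u))

  ⟨row,row⟩≡ℓ : ∀ {u v} → u ~ v → ⟨ row G u , row G v ⟩ ≡ + ℓ
  ⟨row,row⟩≡ℓ {u} {v} u~v =
    trans (⟨row,row⟩≡codegree G u v) (cong +_ (adjacent u v (λ u≡v → ~-irrefl u≡v u~v) u~v))

  ⟨row,row⟩≡μ : ∀ {u v} → u ≢ v → ¬ u ~ v → ⟨ row G u , row G v ⟩ ≡ + μ
  ⟨row,row⟩≡μ {u} {v} u≢v u≁v = trans (⟨row,row⟩≡codegree G u v) (cong +_ (nonadjacent u v u≢v u≁v))

  -- The entries of A² = μ J + D A + (k - μ) I: the value is k on the diagonal, λ on edges and μ on
  -- non-edges.
  gram : ∀ u v → ⟨ row G u , row G v ⟩ ≡ (+ μ + D * row G u v) + (+ k - + μ) * δ u v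
  gram u v = by-cases (u Fin.≟ v) (u ~? v)
    where
    eqk : ∀ k ℓ μ → k ≡ (μ + (ℓ - μ) * 0ℤ) + (k - μ) * 1ℤ
    eqk = solve-∀
    eqℓ : ∀ k ℓ μ → ℓ ≡ (μ + (ℓ - μ) * 1ℤ) + (k - μ) * 0ℤ
    eqℓ = solve-∀
    eqμ : ∀ k ℓ μ → μ ≡ (μ + (ℓ - μ) * 0ℤ) + (k - μ) * 0ℤ
    eqμ = solve-∀
    -- With the decisions as arguments, only the right side is split and the inner product stays
    -- intact.
    by-cases : (u≟v : Dec (u ≡ v)) (u~?v : Dec (u ~ v)) →
               ⟨ row G u , row G v ⟩ ≡ (+ μ + D * 𝟙 (does u~?v)) + (+ k - + μ) * 𝟙 (does u≟v)
    by-cases (yes u≡v)  (yes u~v) = contradiction u~v (~-irrefl u≡v)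
    by-cases (yes refl) (no  _)   = trans (⟨row,row⟩≡k u) (eqk (+ k) (+ ℓ) (+ μ))
    by-cases (no  _)    (yes u~v) = trans (⟨row,row⟩≡ℓ u~v) (eqℓ (+ k) (+ ℓ) (+ μ))
    by-cases (no  u≢v)  (no  u≁v) = trans (⟨row,row⟩≡μ u≢v u≁v) (eqμ (+ k) (+ ℓ) (+ μ))

  -- Both sides count the walks of length two from u.
  k*k≡ : Fin n → + k * + k ≡ (+ n * + μ + D * + k) + (+ k - + μ)
  k*k≡ u = begin
    + k * + k
      ≡⟨ cong (λ s → + k * s) (∑row u) ⟨
    + k * sum (row G u)
      ≡⟨ ∑-*ˡ (+ k) (row G u) ⟨
    sum (λ w → + k * row G u w)
      ≡⟨ ∑-cong (λ w → trans (ℤ.*-comm (+ k) (row G u w)) (sym (∑column w))) ⟩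
    sum (λ w → sum (λ v → row G u w * row G v w))
      -- From walks grouped by their middle vertex w to walks grouped by their last vertex v.
      ≡⟨ ∑-comm (λ w v → row G u w * row G v w) ⟩
    sum (λ v → ⟨ row G u , row G v ⟩)
      ≡⟨ ∑-cong (gram u) ⟩
    sum (λ v → (+ μ + D * row G u v) + c * δ u v)
      ≡⟨ ∑-distrib-+ (λ v → + μ + D * row G u v) (λ v → c * δ u v) ⟩
    sum (λ v → + μ + D * row G u v) + sum (λ v → c * δ u v)
      ≡⟨ cong₂ _+_ (∑-distrib-+ (λ _ → + μ) (λ v → D * row G u v)) (∑-*ˡ c (δ u)) ⟩
    (sum {n} (λ _ → + μ) + sum (λ v → D * row G u v)) + c * sum (δ u)
      ≡⟨ cong₂ _+_ (cong₂ _+_ (∑-const n (+ μ)) (trans (∑-*ˡ D (row G u)) (cong (λ s → D * s) (∑row u))))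
           (trans (cong (λ s → c * s) (∑-δ u)) (ℤ.*-identityʳ c)) ⟩
    (+ n * + μ + D * + k) + c
      ∎
    where
    open ≡-Reasoning
    c = + k - + μ
    ∑row : ∀ u → sum (row G u) ≡ + k
    ∑row u = trans (∑-row G u) (cong +_ (regular u))
    ∑column : ∀ w → sum (λ v → row G u w * row G v w) ≡ row G u w * + k
    ∑column w = trans (∑-*ˡ (row G u w) (λ v → row G v w))
      (cong (λ s → row G u w * s) (trans (∑-cong (λ v → row-sym G v w)) (∑row w)))

  module _ {c : ℕ} (D≤h : D ≤ + k - + c) (-D≤h : - D ≤ + k - + c) (0<h : 0ℤ < + k - + c) where

    private
      h : ℤ
      h = + k - + c

      -- The constant `c` is λ when the argument is applied to a clique and μ when it is applied to
      -- an independent set.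
      _≐_ : Fin n → Fin n → Set
      u ≐ v = ⟨ row G u , row G v ⟩ ≡ + c

      -- The squared norm 2 (k - c) of a difference of two rows with inner product `c`.
      H : ℤ
      H = h + h

      ‖⊖‖≡H : ∀ {u v} → u ≐ v → ⟨ row G u ⊖ row G v , row G u ⊖ row G v ⟩ ≡ H
      ‖⊖‖≡H {u} {v} u≐v = trans (⟨⊖,⊖⟩ (row G u) (row G v) (row G u) (row G v))
        (trans (cong₂ _-_ (cong₂ _-_ (⟨row,row⟩≡k u) u≐v)
                          (cong₂ _-_ (trans (⟨⟩-comm (row G v) (row G u)) u≐v) (⟨row,row⟩≡k v)))
               (eq (+ k) (+ c)))
        where
        eq : ∀ k c → (k - c) - (c - k) ≡ (k - c) + (k - c)
        eq = solve-∀

      orthogonal : ∀ {u v a b} → u ≐ a → u ≐ b → v ≐ a → v ≐ b →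
                   ⟨ row G u ⊖ row G v , row G a ⊖ row G b ⟩ ≡ 0ℤ
      orthogonal {u} {v} {a} {b} ua ub va vb = trans (⟨⊖,⊖⟩ (row G u) (row G v) (row G a) (row G b))
        (trans (cong₂ _-_ (cong₂ _-_ ua ub) (cong₂ _-_ va vb)) (eq (+ c)))
        where
        eq : ∀ c → (c - c) - (c - c) ≡ 0ℤ
        eq = solve-∀

      -- Up to the entries at u and v, row u − row v is an eigenvector for D.
      nearEigenvector : ∀ {u v} → u ≐ v → ∀ w → let x = row G u ⊖ row G v in
                        (D * D) * (x w * x w) ≤ ⟨ x , row G w ⟩ * ⟨ x , row G w ⟩
      nearEigenvector {u} {v} u≐v w with u Fin.≟ w | v Fin.≟ w
      -- At w = u the entry of x is 0 or -1 and ⟨x, A_u⟩ = h, so |D| ≤ h suffices.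
      ... | yes refl | _ = subst₂ (λ s t → (D * D) * (s * s) ≤ t * t)
            (cong (λ s → 1ℤ * s + -1ℤ * row G v u) (sym (row-diagonal G u)))
            (sym (trans (⟨⊖,⟩ (row G u) (row G v) (row G u))
                   (cong₂ _-_ (⟨row,row⟩≡k u) (trans (⟨⟩-comm (row G v) (row G u)) u≐v))))
            (bound (adj G v u))
        where
        bound : ∀ b → let t = 1ℤ * 0ℤ + -1ℤ * 𝟙 b in (D * D) * (t * t) ≤ h * h
        bound false = subst (_≤ h * h) (sym (ℤ.*-zeroʳ (D * D))) (0≤i*i h)
        bound true  = subst (_≤ h * h) (sym (ℤ.*-identityʳ (D * D))) (square-mono D≤h -D≤h)
      -- At w = v the entry is 0 or 1 and the inner product is -h.
      ... | no _ | yes refl = subst₂ (λ s t → (D * D) * (s * s) ≤ t * t)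
            (cong (λ s → 1ℤ * row G u v + -1ℤ * s) (sym (row-diagonal G v)))
            (sym (trans (⟨⊖,⟩ (row G u) (row G v) (row G v)) (cong₂ _-_ u≐v (⟨row,row⟩≡k v))))
            (bound (adj G u v))
        where
        eq : ∀ k c → (k - c) * (k - c) ≡ (c - k) * (c - k)
        eq = solve-∀
        bound : ∀ b → let t = 1ℤ * 𝟙 b + -1ℤ * 0ℤ; h′ = + c - + k in (D * D) * (t * t) ≤ h′ * h′
        bound false = subst (_≤ _) (sym (ℤ.*-zeroʳ (D * D))) (0≤i*i (+ c - + k))
        bound true  = subst₂ _≤_ (sym (ℤ.*-identityʳ (D * D))) (eq (+ k) (+ c)) (square-mono D≤h -D≤h)
      -- Elsewhere the diagonal term of `gram` vanishes and the inner product is exactly D x(w).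
      ... | no u≢w | no v≢w = ℤ.≤-reflexive (trans (eq D x) (cong (λ s → s * s) (sym (begin
            ⟨ row G u ⊖ row G v , row G w ⟩ ≡⟨ ⟨⊖,⟩ (row G u) (row G v) (row G w) ⟩
            ⟨ row G u , row G w ⟩ - ⟨ row G v , row G w ⟩ ≡⟨ cong₂ _-_ (off u≢w) (off v≢w) ⟩
            (+ μ + D * row G u w) - (+ μ + D * row G v w) ≡⟨ eq₂ (+ μ) D (row G u w) (row G v w) ⟩
            D * x ∎))))
        where
        open ≡-Reasoning
        x = (row G u ⊖ row G v) w
        eq : ∀ d x → (d * d) * (x * x) ≡ (d * x) * (d * x)
        eq = solve-∀
        eq₂ : ∀ m d x y → (m + d * x) - (m + d * y) ≡ d * (1ℤ * x + -1ℤ * y)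
        eq₂ = solve-∀
        off : ∀ {u} → u ≢ w → ⟨ row G u , row G w ⟩ ≡ + μ + D * row G u w
        off {u} u≢w = trans (gram u w) (trans
          (cong (λ b → (+ μ + D * row G u w) + (+ k - + μ) * 𝟙 b) (dec-false (u Fin.≟ w) u≢w))
          (trans (cong (λ s → (+ μ + D * row G u w) + s) (ℤ.*-zeroʳ (+ k - + μ))) (ℤ.+-identityʳ _)))

    -- Consider the sum of ⟨x, A_w⟩² over the t differences x and all vertices w. Each x contributes
    -- at least D² H by `nearEigenvector`, and each w at most H k by Bessel. The positive factor H
    -- cancels.
    homogeneous-bound : ∀ t us → length us ≡ t ℕ.* 2 →
                        AllPairs (λ u v → ⟨ row G u , row G v ⟩ ≡ + c) us →
                        + t * (D * D) ≤ + n * + k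
    homogeneous-bound t us len pairs = ℤ.*-cancelʳ-≤-pos _ _ H (begin
      (+ t * (D * D)) * H                                       ≡⟨ ℤ.*-assoc (+ t) (D * D) H ⟩
      + t * ((D * D) * H)
        ≡⟨ cong (λ s → + s * ((D * D) * H)) (length-differences (row G) t us len) ⟨
      + length xs * ((D * D) * H)
        ≤⟨ listSum-≥ (All-differences (row G) lower pairs) ⟩
      listSum (λ x → sum (λ w → ⟨ x , row G w ⟩ * ⟨ x , row G w ⟩)) xs
        ≡⟨ ∑-listSum-comm (λ x w → ⟨ x , row G w ⟩ * ⟨ x , row G w ⟩) xs ⟨
      sum (λ w → listSum (λ x → ⟨ x , row G w ⟩ * ⟨ x , row G w ⟩) xs) ≤⟨ ∑-mono-≤ upper ⟩
      sum {n} (λ _ → H * + k)                                   ≡⟨ ∑-const n (H * + k) ⟩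
      + n * (H * + k)                                           ≡⟨ eq (+ n) H (+ k) ⟩
      (+ n * + k) * H                                           ∎)
      where
      open ℤ.≤-Reasoning
      xs = differences (row G) us
      0<H : 0ℤ < H
      0<H = ℤ.+-mono-< 0<h 0<h
      instance _ = ℤ.positive 0<H
      eq : ∀ n H k → n * (H * k) ≡ (n * k) * H
      eq = solve-∀
      lower : ∀ {u v} → u ≐ v → let x = row G u ⊖ row G v in
              (D * D) * H ≤ sum (λ w → ⟨ x , row G w ⟩ * ⟨ x , row G w ⟩)
      lower {u} {v} u≐v = subst (_≤ _)
        (trans (∑-*ˡ (D * D) (λ w → x w * x w)) (cong (λ s → (D * D) * s) (‖⊖‖≡H u≐v)))
        (∑-mono-≤ (nearEigenvector u≐v))
        where x = row G u ⊖ row G v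
      upper : ∀ w → listSum (λ x → ⟨ x , row G w ⟩ * ⟨ x , row G w ⟩) xs ≤ H * + k
      upper w = subst (λ s → listSum (λ x → ⟨ x , row G w ⟩ * ⟨ x , row G w ⟩) xs ≤ H * s) (⟨row,row⟩≡k w)
        (bessel H 0<H xs (All-differences (row G) ‖⊖‖≡H pairs)
          (AllPairs-differences (row G) orthogonal pairs) (row G w))

-- The bound on λ − μ

∣m-n∣≤ : ∀ {m n o} → m ℕ.≤ o → n ℕ.≤ o → ∣ + m - + n ∣ ℕ.≤ o
∣m-n∣≤ {m} {n} m≤o n≤o = ℕ.≤-trans
  (subst (λ i → ∣ i ∣ ℕ.≤ m ℕ.⊔ n) (sym (ℤ.m-n≡m⊖n m n)) (ℤ.∣m⊝n∣≤m⊔n m n)) (ℕ.⊔-lub m≤o n≤o)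

square-cancel-≤ : ∀ {m n} → m ℕ.* m ℕ.≤ n ℕ.* n → m ℕ.≤ n
square-cancel-≤ {m} {n} m²≤n² = ℕ.≮⇒≥ (λ n<m → ℕ.<⇒≱ (ℕ.*-mono-< n<m n<m) m²≤n²)

∣i∣*∣i∣≡i*i : ∀ i → + (∣ i ∣ ℕ.* ∣ i ∣) ≡ i * i
∣i∣*∣i∣≡i*i i = trans (cong +_ (sym (ℤ.abs-* i i))) (ℤ.0≤i⇒+∣i∣≡i (0≤i*i i))

module _ {n : ℕ} (G : Graph (Fin n)) {k ℓ μ : ℕ}
         (srg : IsStronglyRegular G k ℓ μ) (nontrivial : Nontrivial G) where
  open Graph G
  open IsStronglyRegular srg
  open StronglyRegular G srg

  -- Regularity makes every closed neighbourhood have k + 1 vertices, so without the path the graph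
  -- would be a union of cliques.
  path : ∃[ u ] ∃[ w ] ∃[ v ] u ~ w × w ~ v × u ≢ v × ¬ u ~ v
  path with inducedPath G
  ... | inj₂ p       = p
  ... | inj₁ cliques = contradiction (inj₁ (cliques (suc k) size)) nontrivial
    where
    size : ∀ u → length (closedNeighbourhood G u) ≡ suc k
    size u = ℤ.+-injective (trans (length-closedNeighbourhood G u)
      (cong (λ s → 1ℤ + s) (trans (∑-row G u) (cong +_ (regular u)))))

  -- The argument for `path` in the complement. Its ends are distinct and not adjacent there, hence
  -- adjacent in `G` because adjacency is decidable.
  copath : ∃[ u ] ∃[ w ] ∃[ v ] (u ≢ w × ¬ u ~ w) × (w ≢ v × ¬ w ~ v) × u ~ v
  copath with inducedPath (complement G)
  ... | inj₂ (u , w , v , u≁w , w≁v , u≢v , ¬u≁v) =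
        u , w , v , u≁w , w≁v , decidable-stable (u ~? v) (λ u≁v → ¬u≁v (u≢v , u≁v))
  ... | inj₁ cliques = contradiction (inj₂ (cliques ∣ + n - + k ∣ size)) nontrivial
    where
    size : ∀ u → length (closedNeighbourhood (complement G) u) ≡ ∣ + n - + k ∣
    -- Absolute values turn the integer identity with n - k into one between natural numbers.
    size u = cong ∣_∣ (trans (length-closedNeighbourhood (complement G) u)
      (trans (∑-row-complement G u) (cong (λ d → + n - + d) (regular u))))

  k≤n : k ℕ.≤ n
  k≤n = let u , _ = path in subst (ℕ._≤ n) (regular u) (count≤n (u ~?_) (Vec.allFin n))

  private
    swapped : ∀ {u v z} → ⟨ row G u , row G v ⟩ ≡ z → ⟨ row G v , row G u ⟩ ≡ z
    swapped {u} {v} = trans (⟨⟩-comm (row G v) (row G u))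

    -- The squared norm of A_u - A_v is 2 (k - c).
    0≤k-c : ∀ {c u v} → ⟨ row G u , row G v ⟩ ≡ + c → 0ℤ ≤ + k - + c
    0≤k-c {c} {u} {v} uv = ℤ.*-cancelˡ-≤-pos 0ℤ (+ k - + c) (+ 2) (subst (0ℤ ≤_)
      (trans (⟨⊖,⊖⟩ (row G u) (row G v) (row G u) (row G v))
        (trans (cong₂ _-_ (cong₂ _-_ (⟨row,row⟩≡k u) uv) (cong₂ _-_ (swapped {u} {v} uv) (⟨row,row⟩≡k v)))
               (eq (+ k) (+ c))))
      (0≤⟨f,f⟩ (row G u ⊖ row G v)))
      where
      eq : ∀ k c → (k - c) - (c - k) ≡ + 2 * (k - c)
      eq = solve-∀

    -- Expanding 0 ≤ ⟨A_u - A_w, A_v - A_w⟩ = c - 2b + k. This is the triangle inequality for the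
    -- sizes 2 (k - b), 2 (k - b), 2 (k - c) of symmetric differences of neighbourhoods.
    triangle : ∀ {u w v b c} → ⟨ row G u , row G w ⟩ ≡ b → ⟨ row G w , row G v ⟩ ≡ b →
               ⟨ row G u , row G v ⟩ ≡ c → b - c ≤ + k - b
    triangle {u} {w} {v} {b} {c} uw wv uv = ≤-by-difference (eq (+ k) b c) (subst (0ℤ ≤_)
      (trans (⟨⊖,⊖⟩ (row G u) (row G w) (row G v) (row G w))
             (cong₂ _-_ (cong₂ _-_ uv uw) (cong₂ _-_ wv (⟨row,row⟩≡k w))))
      (0≤⟨⊖,⊖⟩ (adj G u) (adj G w) (adj G v)))
      where
      eq : ∀ k b c → (k - b) - (b - c) ≡ (c - b) - (b - k)
      eq = solve-∀

  0≤k-ℓ : 0ℤ ≤ + k - + ℓ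
  0≤k-ℓ = let u , w , _ , u~w , _ = path in 0≤k-c {ℓ} {u} {w} (⟨row,row⟩≡ℓ u~w)

  0≤k-μ : 0ℤ ≤ + k - + μ
  0≤k-μ = let u , w , _ , (u≢w , u≁w) , _ = copath in 0≤k-c {μ} {u} {w} (⟨row,row⟩≡μ u≢w u≁w)

  D≤k-ℓ : D ≤ + k - + ℓ
  D≤k-ℓ = let u , w , v , u~w , w~v , u≢v , u≁v = path in
    triangle {u} {w} {v} (⟨row,row⟩≡ℓ u~w) (⟨row,row⟩≡ℓ w~v) (⟨row,row⟩≡μ u≢v u≁v)

  -D≤k-μ : - D ≤ + k - + μ
  -D≤k-μ = let u , w , v , (u≢w , u≁w) , (w≢v , w≁v) , u~v = copath in
    subst (_≤ + k - + μ) (eq (+ ℓ) (+ μ))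
      (triangle {u} {w} {v} (⟨row,row⟩≡μ u≢w u≁w) (⟨row,row⟩≡μ w≢v w≁v) (⟨row,row⟩≡ℓ u~v))
    where
    eq : ∀ ℓ μ → μ - ℓ ≡ - (ℓ - μ)
    eq = solve-∀

  -- This is λ ≤ k, since (k - μ) - D = k - λ.
  D≤k-μ : D ≤ + k - + μ
  D≤k-μ = ≤-by-difference (eq (+ k) (+ ℓ) (+ μ)) 0≤k-ℓ
    where
    eq : ∀ k ℓ μ → (k - μ) - (ℓ - μ) ≡ k - ℓ
    eq = solve-∀

  -- This is μ ≤ k, since (k - λ) + D = k - μ.
  -D≤k-ℓ : - D ≤ + k - + ℓ
  -D≤k-ℓ = ≤-by-difference (eq (+ k) (+ ℓ) (+ μ)) 0≤k-μ
    where
    eq : ∀ k ℓ μ → (k - ℓ) - - (ℓ - μ) ≡ k - μ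
    eq = solve-∀

  -- Ramsey's theorem yields 2t vertices forming a clique or an independent set, two for each of t
  -- differences. If D is not 0, one of D and -D is positive, so k - λ and k - μ, which bound both,
  -- are positive as `homogeneous-bound` requires.
  ∣D∣-bound : ∀ t → 2 ℕ.^ (t ℕ.* 2 ℕ.+ t ℕ.* 2) ℕ.≤ n → t ℕ.* (∣ D ∣ ℕ.* ∣ D ∣) ℕ.≤ n ℕ.* n
  ∣D∣-bound t big = ℤ.drop‿+≤+ (subst₂ _≤_
    (sym (trans (ℤ.pos-* t (∣ D ∣ ℕ.* ∣ D ∣)) (cong (λ s → + t * s) (∣i∣*∣i∣≡i*i D))))
    (sym (ℤ.pos-* n n))
    (bound (D ℤ.≟ 0ℤ)))
    where
    n*k≤n*n : + n * + k ≤ + n * + n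
    n*k≤n*n = ℤ.*-monoˡ-≤-nonNeg (+ n) (ℤ.+≤+ k≤n)

    0<h : ∀ {h} → D ≢ 0ℤ → D ≤ h → - D ≤ h → 0ℤ < h
    0<h D≢0 D≤h -D≤h with ℤ.<-cmp 0ℤ D
    ... | tri< 0<D _ _ = ℤ.<-≤-trans 0<D D≤h
    ... | tri≈ _ 0≡D _ = contradiction (sym 0≡D) D≢0
    ... | tri> _ _ D<0 = ℤ.<-≤-trans (ℤ.neg-mono-< D<0) -D≤h

    bound : Dec (D ≡ 0ℤ) → + t * (D * D) ≤ + n * + n
    bound (yes D≡0) = subst (_≤ + n * + n)
      (sym (trans (cong (λ d → + t * (d * d)) D≡0) (ℤ.*-zeroʳ (+ t)))) (0≤i*i (+ n))
    bound (no D≢0)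
      with ramsey _~?_ (t ℕ.* 2) (t ℕ.* 2) (List.allFin n)
             (subst (2 ℕ.^ (t ℕ.* 2 ℕ.+ t ℕ.* 2) ℕ.≤_) (sym (List.length-tabulate {n = n} id)) big)
             (Unique.allFin⁺ n)
    ... | inj₁ (us , len , pairs) = ℤ.≤-trans
          (homogeneous-bound D≤k-ℓ -D≤k-ℓ (0<h D≢0 D≤k-ℓ -D≤k-ℓ) t us len
            (AllPairs.map (λ (_ , u~v) → ⟨row,row⟩≡ℓ u~v) pairs)) n*k≤n*n
    ... | inj₂ (us , len , pairs) = ℤ.≤-trans
          (homogeneous-bound D≤k-μ -D≤k-μ (0<h D≢0 D≤k-μ -D≤k-μ) t us len
            (AllPairs.map (λ (u≢v , u≁v) → ⟨row,row⟩≡μ u≢v u≁v) pairs)) n*k≤n*n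

  -- Deviations of λ and μ from k²/n

  private
    k*k : + (k ℕ.* k) ≡ (+ n * + μ + D * + k) + (+ k - + μ)
    k*k = trans (ℤ.pos-* k k) (k*k≡ (proj₁ path))

    μ≤n : μ ℕ.≤ n
    μ≤n = ℕ.≤-trans (ℤ.drop‿+≤+ (ℤ.0≤i-j⇒j≤i 0≤k-μ)) k≤n

    -- Once k² is replaced by the count of walks, n λ - k² and n μ - k² both take the form a D + (μ
    -- - k), with a = n - k and a = -k respectively.
    small : ∀ {i a} → ∣ a ∣ ℕ.≤ n → i ≡ a * D + (+ μ - + k) → ∣ i ∣ ℕ.≤ n ℕ.* ∣ D ∣ ℕ.+ n
    small {i} {a} ∣a∣≤n refl = begin
      ∣ a * D + (+ μ - + k) ∣            ≤⟨ ℤ.∣i+j∣≤∣i∣+∣j∣ (a * D) (+ μ - + k) ⟩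
      ∣ a * D ∣ ℕ.+ ∣ + μ - + k ∣        ≡⟨ cong (ℕ._+ ∣ + μ - + k ∣) (ℤ.abs-* a D) ⟩
      ∣ a ∣ ℕ.* ∣ D ∣ ℕ.+ ∣ + μ - + k ∣  ≤⟨ ℕ.+-mono-≤ (ℕ.*-monoˡ-≤ ∣ D ∣ ∣a∣≤n) (∣m-n∣≤ μ≤n k≤n) ⟩
      n ℕ.* ∣ D ∣ ℕ.+ n                  ∎
      where open ℕ.≤-Reasoning

  ℓ-deviation : ∣ + ℓ * + n - + (k ℕ.* k) ∣ ℕ.≤ n ℕ.* ∣ D ∣ ℕ.+ n
  ℓ-deviation = small {a = + n - + k} (∣m-n∣≤ ℕ.≤-refl k≤n)
    (trans (cong (λ s → + ℓ * + n - s) k*k) (eq (+ n) (+ k) (+ ℓ) (+ μ)))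
    where
    eq : ∀ n k ℓ μ → ℓ * n - ((n * μ + (ℓ - μ) * k) + (k - μ)) ≡ (n - k) * (ℓ - μ) + (μ - k)
    eq = solve-∀

  μ-deviation : ∣ + μ * + n - + (k ℕ.* k) ∣ ℕ.≤ n ℕ.* ∣ D ∣ ℕ.+ n
  μ-deviation = small {a = - + k} (subst (ℕ._≤ n) (sym (ℤ.∣-i∣≡∣i∣ (+ k))) k≤n)
    (trans (cong (λ s → + μ * + n - s) k*k) (eq (+ n) (+ k) (+ ℓ) (+ μ)))
    where
    eq : ∀ n k ℓ μ → μ * n - ((n * μ + (ℓ - μ) * k) + (k - μ)) ≡ (- k) * (ℓ - μ) + (μ - k)
    eq = solve-∀

-- Let q be the denominator of ε. A positive ε has numerator at least 1, so ε ≥ 1/q and |a - b/n| =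
-- |a n - b| / n ≤ n / q ≤ ε n. The computation passes to unnormalised fractions, whose numerators
-- and denominators are explicit.
deviation-≤ : ∀ ε → 0ℚ ℚ.< ε → ∀ a b n .{{_ : NonZero n}} →
              ℚ.↧ₙ ε ℕ.* ∣ + a * + n - + b ∣ ℕ.≤ n ℕ.* n →
              ℚ.∣ + a ℚ./ 1 ℚ.- + b ℚ./ n ∣ ℚ.≤ ε ℚ.* (+ n ℚ./ 1)
deviation-≤ ε@(ℚ.mkℚ (+ zero) q-1 _)   (ℚ.*<* (ℤ.+<+ ())) a b n small
deviation-≤ ε@(ℚ.mkℚ ℤ.-[1+ _ ] q-1 _) (ℚ.*<* ())         a b n small
deviation-≤ ε@(ℚ.mkℚ (+ suc p) q-1 _)  _                  a b (suc n) small = ℚ.toℚᵘ-cancel-≤ (begin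
  ℚ.toℚᵘ ℚ.∣ x ℚ.- y ∣              ≃⟨ ℚ.toℚᵘ-homo-∣-∣ (x ℚ.- y) ⟩
  ℚᵘ.∣ ℚ.toℚᵘ (x ℚ.- y) ∣           ≃⟨ ℚᵘ.∣-∣-cong (ℚᵘ.≃-trans (ℚ.toℚᵘ-homo-+ x (ℚ.- y))
                                        (ℚᵘ.+-cong (ℚ.toℚᵘ-fromℚᵘ xᵘ)
                                          (ℚᵘ.≃-trans (ℚ.toℚᵘ-homo‿- y) (ℚᵘ.-‿cong (ℚ.toℚᵘ-fromℚᵘ yᵘ))))) ⟩
  ℚᵘ.∣ xᵘ ℚᵘ.- yᵘ ∣                 ≤⟨ ℚᵘ.*≤* (subst₂ _≤_ lhs rhs (ℤ.+≤+ small′)) ⟩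
  ℚ.toℚᵘ ε ℚᵘ.* zᵘ                  ≃⟨ ℚᵘ.*-congˡ {ℚ.toℚᵘ ε} (ℚ.toℚᵘ-fromℚᵘ zᵘ) ⟨
  ℚ.toℚᵘ ε ℚᵘ.* ℚ.toℚᵘ z            ≃⟨ ℚ.toℚᵘ-homo-* ε z ⟨
  ℚ.toℚᵘ (ε ℚ.* z)                  ∎)
  where
  open ℚᵘ.≤-Reasoning
  N = suc n
  q = suc q-1
  xᵘ = mkℚᵘ (+ a) 0
  yᵘ = mkℚᵘ (+ b) n
  zᵘ = mkℚᵘ (+ N) 0
  x = + a ℚ./ 1
  y = + b ℚ./ N
  z = + N ℚ./ 1
  small′ : ∣ + a * + N - + b ∣ ℕ.* q ℕ.≤ suc p ℕ.* (N ℕ.* N)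
  small′ = ℕ.≤-trans (subst (ℕ._≤ N ℕ.* N) (ℕ.*-comm q ∣ + a * + N - + b ∣) small) (ℕ.m≤n*m (N ℕ.* N) (suc p))
  -- `lhs` and `rhs` match the cross-multiplied sides: q · 1 is the denominator of ε n, and 1 · N
  -- that of the difference.
  lhs : + (∣ + a * + N - + b ∣ ℕ.* q) ≡ + ∣ + a * + N + (- + b) * + 1 ∣ * + (q ℕ.* 1)
  lhs = trans (cong₂ (λ s t → + (∣ + a * + N + s ∣ ℕ.* t)) (sym (ℤ.*-identityʳ (- + b))) (sym (ℕ.*-identityʳ q)))
    (ℤ.pos-* ∣ + a * + N + (- + b) * + 1 ∣ (q ℕ.* 1))
  rhs : + (suc p ℕ.* (N ℕ.* N)) ≡ (+ suc p * + N) * + (1 ℕ.* N)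
  rhs = trans (cong +_ (trans (sym (ℕ.*-assoc (suc p) N N)) (cong (suc p ℕ.* N ℕ.*_) (sym (ℕ.*-identityˡ N)))))
    (trans (ℤ.pos-* (suc p ℕ.* N) (1 ℕ.* N)) (cong (λ s → s * + (1 ℕ.* N)) (ℤ.pos-* (suc p) N)))

-- For T = (2q)², the bound T d² ≤ n² says 2qd ≤ n.
scaled-bound : ∀ q n d e → (2 ℕ.* q) ℕ.* (2 ℕ.* q) ℕ.* (d ℕ.* d) ℕ.≤ n ℕ.* n → 2 ℕ.* q ℕ.≤ n →
               e ℕ.≤ n ℕ.* d ℕ.+ n → q ℕ.* e ℕ.≤ n ℕ.* n
scaled-bound q n d e T≤ 2q≤n e≤ = begin
  q ℕ.* e                 ≤⟨ ℕ.*-monoʳ-≤ q e≤ ⟩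
  q ℕ.* (n ℕ.* d ℕ.+ n)   ≡⟨ eq₁ q n d ⟩
  n ℕ.* (q ℕ.* d ℕ.+ q)   ≤⟨ ℕ.*-monoʳ-≤ n (ℕ.*-cancelˡ-≤ 2 (begin
    2 ℕ.* (q ℕ.* d ℕ.+ q)       ≡⟨ eq₂ q d ⟩
    2 ℕ.* q ℕ.* d ℕ.+ 2 ℕ.* q
      -- The term with d and the additive error n each use up half of the allowance.
      ≤⟨ ℕ.+-mono-≤ 2qd≤n 2q≤n ⟩
    n ℕ.+ n                     ≡⟨ eq₄ n ⟩
    2 ℕ.* n                     ∎)) ⟩
  n ℕ.* n                 ∎
  where
  open ℕ.≤-Reasoning
  eq₁ : ∀ q n d → q ℕ.* (n ℕ.* d ℕ.+ n) ≡ n ℕ.* (q ℕ.* d ℕ.+ q)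
  eq₁ = ℕ-Solver.solve-∀
  eq₂ : ∀ q d → 2 ℕ.* (q ℕ.* d ℕ.+ q) ≡ 2 ℕ.* q ℕ.* d ℕ.+ 2 ℕ.* q
  eq₂ = ℕ-Solver.solve-∀
  eq₃ : ∀ r d → r ℕ.* r ℕ.* (d ℕ.* d) ≡ (r ℕ.* d) ℕ.* (r ℕ.* d)
  eq₃ = ℕ-Solver.solve-∀
  eq₄ : ∀ n → n ℕ.+ n ≡ 2 ℕ.* n
  eq₄ = ℕ-Solver.solve-∀
  2qd≤n : 2 ℕ.* q ℕ.* d ℕ.≤ n
  2qd≤n = square-cancel-≤ (subst (ℕ._≤ n ℕ.* n) (eq₃ (2 ℕ.* q) d) T≤)

theorem1 : ∀ (ε : ℚ) → 0ℚ ℚ.< ε →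
    ∃[ n₀ ] (∀ (n k ℓ μ : ℕ) .{{_ : NonZero n}} (G : Graph (Fin n)) →
    IsStronglyRegular G k ℓ μ → Nontrivial G → n₀ ℕ.≤ n →
    (ℚ.∣ + ℓ ℚ./ 1 ℚ.- + (k ℕ.* k) ℚ./ n ∣ ℚ.≤ ε ℚ.* (+ n ℚ./ 1))
    × (ℚ.∣ + μ ℚ./ 1 ℚ.- + (k ℕ.* k) ℚ./ n ∣ ℚ.≤ ε ℚ.* (+ n ℚ./ 1)))
-- The first summand of the threshold ensures 2q ≤ n, which absorbs the additive error; the second
-- is the Ramsey bound for T pairs.
theorem1 ε 0<ε = 2 ℕ.* q ℕ.+ 2 ℕ.^ (T ℕ.* 2 ℕ.+ T ℕ.* 2) , λ n k ℓ μ G srg nontrivial n₀≤n →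
  let T≤   = ∣D∣-bound G srg nontrivial T (ℕ.≤-trans (ℕ.m≤n+m _ (2 ℕ.* q)) n₀≤n)
      2q≤n = ℕ.≤-trans (ℕ.m≤m+n (2 ℕ.* q) _) n₀≤n
  in deviation-≤ ε 0<ε ℓ (k ℕ.* k) n (scaled-bound q n _ _ T≤ 2q≤n (ℓ-deviation G srg nontrivial))
   , deviation-≤ ε 0<ε μ (k ℕ.* k) n (scaled-bound q n _ _ T≤ 2q≤n (μ-deviation G srg nontrivial))
  where
  q = ℚ.↧ₙ ε
  T = (2 ℕ.* q) ℕ.* (2 ℕ.* q)
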